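{- Let $\mathbf A$ be an algebra of type $\tau$ equipped with a partition system $\sigma\mapsto\langle\odot^\sigma_0,\dots,\odot^\sigma_n\rangle$. Let $\equiv$ be the common equivalence relation $\equiv_\odot$ of the left normal bands in the system, let $I\subseteq A$ be a set of representatives of its classes, made into a join-semilattice $\mathbf I=\langle I,\vee\rangle$ by letting $p\vee q$ be the representative of the class of $p\odot q$ (for any $\odot$ of the system), with order $\preceq$, and let $A_p$ denote the class of $p$. Then: (1) each $A_p$ is closed under all operations of $\mathbf A$ of positive arity, and becomes an algebra $\mathbf A_p$ of type $\tau$ by setting $\omega^{\mathbf A_p}:=\omega^{\mathbf A}\odot^\omega_0 p$ for each constant symbol $\omega$; (2) for all $p\preceq q$ in $\mathbf I$ the assignment $\xi_{pq}$ with $\xi^{\sigma i}_{pq}(a):=a\odot^\sigma_i q$ (for each $n$-ary $\sigma$ and $0\le i\le n$, $a\in A_p$) is a well-defined metamorphism $\mathbf A_p\Rightarrow\mathbf A_q$; (3) $\{\xi_{pq}: p\preceq q\}$ is a semilattice directed system of metamorphisms and $\mathbf A$ is its Płonka sum.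
   Context: A left normal band on a set $A$ is a binary operation $\odot$ with $a\odot a=a$, $a\odot(b\odot c)=(a\odot b)\odot c$, $a\odot(b\odot c)=a\odot(c\odot b)$ for all $a,b,c$. Put $a\preceq_\odot b\iff b\odot a=b$ and $a\equiv_\odot b\iff a\preceq_\odot b$ and $b\preceq_\odot a$; then $\preceq_\odot$ is a preorder, $\equiv_\odot$ a congruence, and the quotient is a join-semilattice. Two left normal bands $\odot,\otimes$ on $A$ are homotactic if $\preceq_\odot=\preceq_\otimes$. For an algebra $\mathbf A$ of type $\tau$, a partition system is an assignment to each $n$-ary operation symbol $\sigma$ (constants: $n=0$) of a tuple $\langle\odot^\sigma_0,\dots,\odot^\sigma_n\rangle$ of left normal bands on $A$, all of them (over all $\sigma$) pairwise homotactic, such that for all $a_1,\dots,a_n,b\in A$: (PF4$^\sigma$) if $n\ge1$, $\sigma^{\mathbf A}(a_1,\dots,a_n)\odot^\sigma_0 b=\sigma^{\mathbf A}(a_1\odot^\sigma_1 b,\dots,a_n\odot^\sigma_n b)$; (PF5$^\sigma$) $b\odot^\sigma_0\sigma^{\mathbf A}(a_1,\dots,a_n)=b\odot^\sigma_0a_1\odot^\sigma_0\cdots\odot^\sigma_0a_n$ (for a constant $\omega$: $b\odot^\omega_0\omega^{\mathbf A}=b$). A metamorphism $f:\mathbf A\Rightarrow\mathbf B$ between algebras of type $\tau$ assigns to each $n$-ary symbol $\sigma$ a tuple of maps $f^{\sigma0},\dots,f^{\sigma n}:A\to B$ such that $f^{\sigma0}(\sigma^{\mathbf A}(a_1,\dots,a_n))=\sigma^{\mathbf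 B}(f^{\sigma1}(a_1),\dots,f^{\sigma n}(a_n))$ (for constants $f^{\omega0}(\omega^{\mathbf A})=\omega^{\mathbf B}$); composition and identities are componentwise. A semilattice directed system of metamorphisms over a join-semilattice $\mathbf I$ is a family of pairwise disjoint algebras $\mathbf A_p$ ($p\in I$) with metamorphisms $\xi_{pq}:\mathbf A_p\Rightarrow\mathbf A_q$ for $p\preceq q$ such that $\xi_{pp}$ is the identity and $\xi_{qr}\circ\xi_{pq}=\xi_{pr}$. Its Płonka sum is the algebra on $\biguplus_pA_p$ with $\sigma(a_1,\dots,a_n):=\sigma^{\mathbf A_q}(\xi^{\sigma1}_{p_1q}(a_1),\dots,\xi^{\sigma n}_{p_nq}(a_n))$ for $a_i\in A_{p_i}$, $q=p_1\vee\dots\vee p_n$, and (if $\tau$ has constants, $\mathbf I$ must have a least element $\bot$) $\omega:=\omega^{\mathbf A_\bot}$. -}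

module Defs where

open import Algebra.Core using (Op₂)
import Algebra.Structures as AlgebraStructures
open import Data.Fin.Base using (Fin; zero; suc)
open import Data.Nat.Base using (ℕ; zero; suc; NonZero)
open import Data.Product.Base using (Σ; Σ-syntax; ∃; _×_; _,_; proj₁; proj₂)
open import Data.Product using (∃!)
open import Data.Vec.Base using (Vec; []; _∷_; lookup; map; tabulate; foldl′; foldr₁)
open import Data.Vec.Relation.Unary.All using (All; []; _∷_)
open import Function.Base using (id; _∘_)
open import Function.Bundles using (_⇔_)
open import Function.Definitions using (Bijective)
open import Level using (Level; _⊔_) renaming (suc to lsuc)
open import Relation.Binary.Core using (Rel)
open import Relation.Binary.Definitions using (Minimum)
open import Relation.Binary.Lattice.Structures using (IsJoinSemilattice)
open import Relation.Binary.PropositionalEquality using (_≡_; refl)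
open import Relation.Unary using (Pred; Irrelevant)

private
  variable
    o a b c i r : Level

------------------------------------------------------------------------
-- Left normal bands

module _ {A : Set a} where

  open AlgebraStructures {A = A} _≡_ using (IsBand)

  record IsLeftNormalBand (_⊙_ : Op₂ A) : Set a where
    field
      isBand     : IsBand _⊙_
      leftNormal : ∀ x y z → x ⊙ (y ⊙ z) ≡ x ⊙ (z ⊙ y)

    open IsBand isBand public

  Preorder : Op₂ A → Rel A a
  Preorder _⊙_ x y = y ⊙ x ≡ y

  Equivalence : Op₂ A → Rel A a
  Equivalence _⊙_ x y = Preorder _⊙_ x y × Preorder _⊙_ y x

  Homotactic : Op₂ A → Op₂ A → Set a
  Homotactic _⊙_ _⊗_ = ∀ x y → Preorder _⊙_ x y ⇔ Preorder _⊗_ x y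

------------------------------------------------------------------------
-- Algebras and metamorphisms

record Signature o : Set (lsuc o) where
  field
    Op    : Set o
    arity : Op → ℕ

open Signature public

-- Constant symbols are the symbols of arity 0.
HasConstant : Signature o → Set o
HasConstant τ = Σ[ ω ∈ Op τ ] arity τ ω ≡ 0

record Algebra (τ : Signature o) a : Set (o ⊔ lsuc a) where
  field
    Carrier : Set a
    ⟦_⟧     : ∀ σ → Vec Carrier (arity τ σ) → Carrier

-- f₁(a₁), …, fₙ(aₙ): a different map is applied at each position.
mapᵢ : ∀ {n} {A : Set a} {B : Set b} → (Fin n → A → B) → Vec A n → Vec B n
mapᵢ f as = tabulate λ k → f k (lookup as k)

module _ {τ : Signature o} where

  open Algebra

  -- Componentwise data: a map for each symbol σ and each index 0 … n.
  Components : Set a → Set b → Set (o ⊔ a ⊔ b)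
  Components A B = ∀ σ → Fin (suc (arity τ σ)) → A → B

  IsMetamorphism : (𝐀 : Algebra τ a) (𝐁 : Algebra τ b) →
                   Components (Carrier 𝐀) (Carrier 𝐁) → Set (o ⊔ a ⊔ b)
  IsMetamorphism 𝐀 𝐁 f = ∀ σ as →
    f σ zero (⟦ 𝐀 ⟧ σ as) ≡ ⟦ 𝐁 ⟧ σ (mapᵢ (λ k → f σ (suc k)) as)

  record Metamorphism (𝐀 : Algebra τ a) (𝐁 : Algebra τ b) : Set (o ⊔ a ⊔ b) where
    field
      component      : Components (Carrier 𝐀) (Carrier 𝐁)
      isMetamorphism : IsMetamorphism 𝐀 𝐁 component

  open Metamorphism public

  idᶜ : {A : Set a} → Components A A
  idᶜ σ k = id

  _∘ᶜ_ : {A : Set a} {B : Set b} {C : Set c} →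
         Components B C → Components A B → Components A C
  (g ∘ᶜ f) σ k = g σ k ∘ f σ k

  _≗ᶜ_ : {A : Set a} {B : Set b} → Rel (Components A B) (o ⊔ a ⊔ b)
  f ≗ᶜ g = ∀ σ k x → f σ k x ≡ g σ k x

  record IsIsomorphism (𝐀 : Algebra τ a) (𝐁 : Algebra τ b)
                       (f : Carrier 𝐀 → Carrier 𝐁) : Set (o ⊔ a ⊔ b) where
    field
      homomorphic : ∀ σ as → f (⟦ 𝐀 ⟧ σ as) ≡ ⟦ 𝐁 ⟧ σ (map f as)
      bijective   : Bijective _≡_ _≡_ f

------------------------------------------------------------------------
-- Semilattice directed systems and their Płonka sums

-- Disjointness of the family is not a field: the Płonka sum below lives on
-- the tagged union Σ I (Carrier ∘ 𝐀).  Since ⪯ may have several proofs, the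
-- laws are required for all of them; in particular ξ does not depend on the
-- proof of p ⪯ q.
record IsDirectedSystem
    {τ : Signature o} {I : Set i} (_⪯_ : Rel I r)
    (𝐀 : I → Algebra τ a)
    (ξ : ∀ {p q} → p ⪯ q → Metamorphism (𝐀 p) (𝐀 q)) : Set (o ⊔ i ⊔ r ⊔ a) where
  field
    identity    : ∀ {p} (pp : p ⪯ p) → component (ξ pp) ≗ᶜ idᶜ
    composition : ∀ {p q s} (pq : p ⪯ q) (qs : q ⪯ s) (ps : p ⪯ s) →
                  (component (ξ qs) ∘ᶜ component (ξ pq)) ≗ᶜ component (ξ ps)

record DirectedSystem (τ : Signature o) i r a : Set (o ⊔ lsuc (i ⊔ r ⊔ a)) where
  field
    Index             : Set i
    _⪯_               : Rel Index r
    _∨_               : Op₂ Index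
    isJoinSemilattice : IsJoinSemilattice _≡_ _⪯_ _∨_
    𝐀                 : Index → Algebra τ a
    ξ                 : ∀ {p q} → p ⪯ q → Metamorphism (𝐀 p) (𝐀 q)
    isDirectedSystem  : IsDirectedSystem _⪯_ 𝐀 ξ

-- A least element of the index semilattice is only required when τ has
-- constants; by antisymmetry it does not depend on the constant.
module _ {τ : Signature o} (S : DirectedSystem τ i r a)
         (least : HasConstant τ → ∃ (Minimum (DirectedSystem._⪯_ S))) where

  open DirectedSystem S
  open IsJoinSemilattice isJoinSemilattice using (x≤x∨y; y≤x∨y; trans)
    renaming (refl to ⪯-refl)
  open Algebra

  Union : Set (i ⊔ a)
  Union = Σ[ p ∈ Index ] Carrier (𝐀 p)

  -- p₁ ∨ … ∨ pₙ, read as the least element when n = 0.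
  join : ∀ {n} → (n ≡ 0 → ∃ (Minimum _⪯_)) → Vec Union n → Index
  join ⊥ []       = proj₁ (⊥ refl)
  join ⊥ (x ∷ xs) = foldr₁ _∨_ (map proj₁ (x ∷ xs))

  join-upper : ∀ {n} (⊥ : n ≡ 0 → ∃ (Minimum _⪯_)) (xs : Vec Union n) k →
               proj₁ (lookup xs k) ⪯ join ⊥ xs
  join-upper ⊥ (x ∷ [])     zero    = ⪯-refl
  join-upper ⊥ (x ∷ y ∷ xs) zero    = x≤x∨y _ _
  join-upper ⊥ (x ∷ y ∷ xs) (suc k) =
    trans (join-upper (λ ()) (y ∷ xs) k) (y≤x∨y _ _)

  PłonkaSum : Algebra τ (i ⊔ a)
  PłonkaSum = record
    { Carrier = Union
    ; ⟦_⟧     = λ σ xs →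
        let ⊥ = λ eq → least (σ , eq)
        in  join ⊥ xs ,
            ⟦ 𝐀 (join ⊥ xs) ⟧ σ
              (tabulate λ k →
                component (ξ (join-upper ⊥ xs k)) σ (suc k) (proj₂ (lookup xs k)))
    }

------------------------------------------------------------------------
-- Partition systems

record PartitionSystem {τ : Signature o} (𝐀 : Algebra τ a) : Set (o ⊔ a) where
  open Algebra 𝐀

  field
    band       : ∀ σ → Fin (suc (arity τ σ)) → Op₂ Carrier
    isLNB      : ∀ σ k → IsLeftNormalBand (band σ k)
    homotactic : ∀ σ k σ′ k′ → Homotactic (band σ k) (band σ′ k′)
    PF4        : ∀ σ → .{{NonZero (arity τ σ)}} → ∀ as b →
                 band σ zero (⟦ σ ⟧ as) b ≡
                 ⟦ σ ⟧ (mapᵢ (λ k x → band σ (suc k) x b) as)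
    PF5        : ∀ σ as b →
                 band σ zero b (⟦ σ ⟧ as) ≡ foldl′ (band σ zero) b as

-- A subset of A (hence proof-irrelevant) meeting each class exactly once.
record Representatives {A : Set a} (_≈_ : Rel A r) i : Set (a ⊔ r ⊔ lsuc i) where
  field
    member         : Pred A i
    irrelevant     : Irrelevant member
    representative : ∀ x → ∃! _≡_ λ p → member p × x ≈ p

-- The modules below take earlier well-definedness claims as parameters because
-- later notions cannot be stated without them; nothing is assumed thereby.
-- All notions refer to the band ⊙ = ⊙^σ₀_k₀, an arbitrary member of the
-- system; any two members have the same preorder.
module Decomposition
    {τ : Signature o} {𝐀 : Algebra τ a} (P : PartitionSystem 𝐀)
    (σ₀ : Op τ) (k₀ : Fin (suc (arity τ σ₀)))
    (R : Representatives (Equivalence (PartitionSystem.band P σ₀ k₀)) i) where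

  open Algebra 𝐀
  open PartitionSystem P
  open Representatives R

  _≈_ : Rel Carrier a
  _≈_ = Equivalence (band σ₀ k₀)

  I : Set (a ⊔ i)
  I = ∃ member

  _⪯_ : Rel I a
  (p , _) ⪯ (q , _) = Preorder (band σ₀ k₀) p q

  _∨_ : Op₂ I
  (p , _) ∨ (q , _) =
    let s , (s∈I , _) , _ = representative (band σ₀ k₀ p q) in s , s∈I

  ∨-Independent : Set (o ⊔ a ⊔ i)
  ∨-Independent = ∀ σ k (p q : I) → band σ k (proj₁ p) (proj₁ q) ≈ proj₁ (p ∨ q)

  Class : I → Set a
  Class (p , _) = Σ[ x ∈ Carrier ] x ≈ p

  Closed : Set (o ⊔ a ⊔ i)
  Closed = ∀ (p : I) σ → .{{NonZero (arity τ σ)}} → ∀ as →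
           All (_≈ proj₁ p) as → ⟦ σ ⟧ as ≈ proj₁ p

  -- For arity 0 the only argument vector is empty, so ⟦ ω ⟧ as is the
  -- constant itself.
  ConstantsClosed : Set (o ⊔ a ⊔ i)
  ConstantsClosed = ∀ (p : I) ω → arity τ ω ≡ 0 → ∀ as →
                    band ω zero (⟦ ω ⟧ as) (proj₁ p) ≈ proj₁ p

  ξ-WellDefined : Set (o ⊔ a ⊔ i)
  ξ-WellDefined = ∀ (p q : I) → p ⪯ q → ∀ σ k (x : Class p) →
                  band σ k (proj₁ x) (proj₁ q) ≈ proj₁ q

  ξ-components : ξ-WellDefined → ∀ p q → p ⪯ q →
                 Components {τ = τ} (Class p) (Class q)
  ξ-components wd p q p⪯q σ k x =
    band σ k (proj₁ x) (proj₁ q) , wd p q p⪯q σ k x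

  -- This map being bijective says that the classes are pairwise disjoint with
  -- union A; being homomorphic for the Płonka sum, that the operations of the
  -- sum are those of 𝐀.
  inclusion : Σ I Class → Carrier
  inclusion (p , x) = proj₁ x

  module ClassAlgebra (closed : Closed) (constants : ConstantsClosed) where

    members : ∀ {n} (p : I) (as : Vec (Class p) n) →
              All (_≈ proj₁ p) (map proj₁ as)
    members p []             = []
    members p ((_ , e) ∷ as) = e ∷ members p as

    restrict : ∀ {n} (p : I) (f : Vec Carrier n → Carrier) (_⊙_ : Op₂ Carrier) →
               (.{{NonZero n}} → ∀ as → All (_≈ proj₁ p) as → f as ≈ proj₁ p) →
               (n ≡ 0 → ∀ as → (f as ⊙ proj₁ p) ≈ proj₁ p) →
               Vec (Class p) n → Class p
    restrict p f _⊙_ cl co []       = f [] ⊙ proj₁ p , co refl []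
    restrict p f _⊙_ cl co (x ∷ xs) =
      f (map proj₁ (x ∷ xs)) , cl (map proj₁ (x ∷ xs)) (members p (x ∷ xs))

    𝐀[_] : I → Algebra τ a
    𝐀[ p ] = record
      { Carrier = Class p
      ; ⟦_⟧     = λ σ → restrict p ⟦ σ ⟧ (band σ zero) (closed p σ) (constants p σ)
      }

    ξ-Metamorphic : ξ-WellDefined → Set (o ⊔ a ⊔ i)
    ξ-Metamorphic wd = ∀ p q (p⪯q : p ⪯ q) →
                       IsMetamorphism 𝐀[ p ] 𝐀[ q ] (ξ-components wd p q p⪯q)

    module Transition (wd : ξ-WellDefined) (metamorphic : ξ-Metamorphic wd) where

      ξ : ∀ {p q} → p ⪯ q → Metamorphism 𝐀[ p ] 𝐀[ q ]
      ξ {p} {q} p⪯q = record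
        { component      = ξ-components wd p q p⪯q
        ; isMetamorphism = metamorphic p q p⪯q
        }

      ξ-Directed : Set (o ⊔ a ⊔ i)
      ξ-Directed = IsDirectedSystem _⪯_ 𝐀[_] λ {p} {q} → ξ {p} {q}

      system : IsJoinSemilattice _≡_ _⪯_ _∨_ → ξ-Directed → DirectedSystem τ (a ⊔ i) a a
      system isJSL directed = record
        { isJoinSemilattice = isJSL
        ; 𝐀                 = 𝐀[_]
        ; ξ                 = λ {p} {q} → ξ {p} {q}
        ; isDirectedSystem  = directed
        }

{-# OPTIONS --safe #-}

-- In a left normal band x ⊙ y is a least upper bound of x and y for ⪯, so
-- homotactic bands agree up to ≈.  By (PF5), σ(a₁,…,aₙ) is a least upper bound
-- of a₁,…,aₙ (a least element when n = 0); hence the classes are closed.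
-- By (PF4) for n ≥ 1, and by the definition of the constants of 𝐀_q for n = 0,
--   σ^{𝐀_q}(a₁ ⊙₁ q,…,aₙ ⊙ₙ q) = σ(a₁,…,aₙ) ⊙₀ q   whenever all aᵢ ⪯ q.
-- This identity makes ξ metamorphic, and for q the join of the classes of the
-- aᵢ its right-hand side is σ(a₁,…,aₙ), which is the Płonka sum formula.
module Submission where

open import Defs
open import Algebra.Core using (Op₂)
open import Data.Fin.Base using (Fin; zero; suc)
open import Data.Nat.Base using (suc; NonZero)
open import Data.Product.Base using (Σ-syntax; ∃; _×_; _,_; proj₁; proj₂)
open import Data.Vec.Base using (Vec; []; _∷_; lookup; map; tabulate; foldl′)
open import Data.Vec.Properties
  using (tabulate∘lookup; lookup∘tabulate; tabulate-cong; lookup-map)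
open import Data.Vec.Relation.Unary.All as All using (All; []; _∷_)
open import Function.Bundles using (module Equivalence)
open import Function.Definitions using (Injective; Surjective)
open import Level using (Level)
open import Relation.Binary.Definitions using (Minimum)
open import Relation.Binary.Lattice.Structures using (IsJoinSemilattice)
open import Relation.Binary.PropositionalEquality
  using (_≡_; refl; sym; trans; cong; cong₂; subst; isEquivalence; module ≡-Reasoning)
open import Relation.Binary.PropositionalEquality.WithK using (≡-irrelevant)

-- Least upper bounds and folds in a single left normal band.

module LeftNormalBand {a} {A : Set a} {_⊙_ : Op₂ A} (isLNB : IsLeftNormalBand _⊙_) where

  open IsLeftNormalBand isLNB using (assoc; idem; leftNormal)

  private
    _⪯_ = Preorder _⊙_

  ⪯-trans : ∀ {x y z} → x ⪯ y → y ⪯ z → x ⪯ z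
  ⪯-trans {x} {y} {z} x⪯y y⪯z = begin
    z ⊙ x        ≡⟨ cong (_⊙ x) y⪯z ⟨
    (z ⊙ y) ⊙ x  ≡⟨ assoc z y x ⟩
    z ⊙ (y ⊙ x)  ≡⟨ cong (z ⊙_) x⪯y ⟩
    z ⊙ y        ≡⟨ y⪯z ⟩
    z            ∎
    where open ≡-Reasoning

  y⪯x⊙y : ∀ x y → y ⪯ (x ⊙ y)
  y⪯x⊙y x y = trans (assoc x y y) (cong (x ⊙_) (idem y))

  x⪯x⊙y : ∀ x y → x ⪯ (x ⊙ y)
  x⪯x⊙y x y = begin
    (x ⊙ y) ⊙ x  ≡⟨ assoc x y x ⟩
    x ⊙ (y ⊙ x)  ≡⟨ leftNormal x y x ⟩
    x ⊙ (x ⊙ y)  ≡⟨ assoc x x y ⟨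
    (x ⊙ x) ⊙ y  ≡⟨ cong (_⊙ y) (idem x) ⟩
    x ⊙ y        ∎
    where open ≡-Reasoning

  ⊙-least : ∀ {x y z} → x ⪯ z → y ⪯ z → (x ⊙ y) ⪯ z
  ⊙-least {x} {y} {z} x⪯z y⪯z =
    trans (sym (assoc z x y)) (trans (cong (_⊙ y) x⪯z) y⪯z)

  -- Behind `x`, left normality swaps `y` and `z`, and `z ⊙ y` collapses to `z`. This is why the
  -- transition maps compose.
  ⊙-absorb : ∀ x {y z} → y ⪯ z → (x ⊙ y) ⊙ z ≡ x ⊙ z
  ⊙-absorb x {y} {z} y⪯z =
    trans (assoc x y z) (trans (leftNormal x y z) (cong (x ⊙_) y⪯z))

  foldl′-fixed : ∀ {n z} {as : Vec A n} → All (_⪯ z) as → foldl′ _⊙_ z as ≡ z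
  foldl′-fixed [] = refl
  foldl′-fixed {as = _ ∷ as} (a⪯z ∷ as⪯z) =
    trans (cong (λ w → foldl′ _⊙_ w as) a⪯z) (foldl′-fixed as⪯z)

  foldl′-inflate : ∀ {n x b} (as : Vec A n) → x ⪯ b → x ⪯ foldl′ _⊙_ b as
  foldl′-inflate []       x⪯b = x⪯b
  foldl′-inflate (a ∷ as) x⪯b = foldl′-inflate as (⪯-trans x⪯b (x⪯x⊙y _ a))

  foldl′-upper : ∀ {n} b (as : Vec A n) → All (_⪯ foldl′ _⊙_ b as) as
  foldl′-upper b []       = []
  foldl′-upper b (a ∷ as) = foldl′-inflate as (y⪯x⊙y b a) ∷ foldl′-upper (b ⊙ a) as

-- The common preorder, and operation values as least upper bounds.

module PartitionOrder {o a} {τ : Signature o} {𝐀 : Algebra τ a} (P : PartitionSystem 𝐀)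
    (σ₀ : Op τ) (k₀ : Fin (suc (arity τ σ₀))) where

  open Algebra 𝐀
  open PartitionSystem P
  private
    module Band σ k = LeftNormalBand (isLNB σ k)
    module Band₀ = LeftNormalBand (isLNB σ₀ k₀)

  infix 4 _⊑_
  _⊑_ : Carrier → Carrier → Set a
  _⊑_ = Preorder (band σ₀ k₀)

  ⊑⇒⪯ : ∀ σ k {x y} → x ⊑ y → Preorder (band σ k) x y
  ⊑⇒⪯ σ k = Equivalence.to (homotactic σ₀ k₀ σ k _ _)

  ⪯⇒⊑ : ∀ σ k {x y} → Preorder (band σ k) x y → x ⊑ y
  ⪯⇒⊑ σ k = Equivalence.from (homotactic σ₀ k₀ σ k _ _)

  ⊑-refl : ∀ {x} → x ⊑ x
  ⊑-refl = IsLeftNormalBand.idem (isLNB σ₀ k₀) _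

  ⊑-trans : ∀ {x y z} → x ⊑ y → y ⊑ z → x ⊑ z
  ⊑-trans = Band₀.⪯-trans

  band-upperˡ : ∀ σ k x y → x ⊑ band σ k x y
  band-upperˡ σ k x y = ⪯⇒⊑ σ k (Band.x⪯x⊙y σ k x y)

  band-upperʳ : ∀ σ k x y → y ⊑ band σ k x y
  band-upperʳ σ k x y = ⪯⇒⊑ σ k (Band.y⪯x⊙y σ k x y)

  band-least : ∀ σ k {x y z} → x ⊑ z → y ⊑ z → band σ k x y ⊑ z
  band-least σ k x⊑z y⊑z = ⪯⇒⊑ σ k (Band.⊙-least σ k (⊑⇒⪯ σ k x⊑z) (⊑⇒⪯ σ k y⊑z))

  band-absorb : ∀ σ k x {y z} → y ⊑ z → band σ k (band σ k x y) z ≡ band σ k x z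
  band-absorb σ k x y⊑z = Band.⊙-absorb σ k x (⊑⇒⪯ σ k y⊑z)

  -- (PF5) at `b = ⟦ σ ⟧ as`: by idempotence the value equals the fold started from itself, and such
  -- a fold lies above every argument.
  op-upper : ∀ σ as → All (_⊑ ⟦ σ ⟧ as) as
  op-upper σ as = All.map (⪯⇒⊑ σ zero)
    (subst (λ z → All (λ x → Preorder (band σ zero) x z) as)
           (trans (sym (PF5 σ as (⟦ σ ⟧ as))) (IsLeftNormalBand.idem (isLNB σ zero) _))
           (Band.foldl′-upper σ zero (⟦ σ ⟧ as) as))

  -- (PF5) at `b = z`: a fold started from `z` stays at `z` when every argument is below `z`.
  op-least : ∀ σ {as z} → All (_⊑ z) as → ⟦ σ ⟧ as ⊑ z
  op-least σ {as} {z} as⊑z = ⪯⇒⊑ σ zero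
    (trans (PF5 σ as z) (Band.foldl′-fixed σ zero (All.map (⊑⇒⪯ σ zero) as⊑z)))

  constant-least : ∀ ω → arity τ ω ≡ 0 → ∀ as z → ⟦ ω ⟧ as ⊑ z
  constant-least ω eq as z = op-least ω (empty eq as)
    where
    -- Stated for a variable `n`, since `arity τ ω ≡ 0` itself cannot be matched against `refl`.
    empty : ∀ {n} → n ≡ 0 → (as : Vec Carrier n) → All (_⊑ z) as
    empty refl [] = []

map≡tabulate : ∀ {a b n} {A : Set a} {B : Set b} {f : A → B} {g : Fin n → B} (xs : Vec A n) →
               (∀ k → f (lookup xs k) ≡ g k) → map f xs ≡ tabulate g
map≡tabulate {f = f} xs eq = trans (sym (tabulate∘lookup (map f xs)))
  (tabulate-cong λ k → trans (lookup-map k f xs) (eq k))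

All-zipHead : ∀ {a p q r n} {A : Set a} {P : A → Set p} {Q : A → Set q} {R : Set r} →
              .{{NonZero n}} → (∀ {x} → P x → Q x → R) →
              {xs : Vec A n} → All P xs → All Q xs → R
All-zipHead f (p ∷ _) (q ∷ _) = f p q

-- Classes, their representatives, and the semilattice of indices.

module PartitionDecomposition
    {o a i} {τ : Signature o} {𝐀 : Algebra τ a} (P : PartitionSystem 𝐀)
    (σ₀ : Op τ) (k₀ : Fin (suc (arity τ σ₀)))
    (R : Representatives (Equivalence (PartitionSystem.band P σ₀ k₀)) i) where

  open Algebra 𝐀
  open PartitionSystem P
  open Representatives R
  open Decomposition P σ₀ k₀ R
  open PartitionOrder P σ₀ k₀

  -- Both halves are equations, so uniqueness of identity proofs applies; elements of a class can
  -- then be compared by their values alone.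
  ≈-irrelevant : ∀ {x y} (e e′ : x ≈ y) → e ≡ e′
  ≈-irrelevant (d , e) (d′ , e′) = cong₂ _,_ (≡-irrelevant d d′) (≡-irrelevant e e′)

  Class-≡ : ∀ {p} {x y : ∃ (_≈ p)} → proj₁ x ≡ proj₁ y → x ≡ y
  Class-≡ {x = x , e} {y = _ , e′} refl = cong (x ,_) (≈-irrelevant e e′)

  I-≡ : ∀ {p q : I} → proj₁ p ≡ proj₁ q → p ≡ q
  I-≡ {p , m} {_ , m′} refl = cong (p ,_) (irrelevant m m′)

  representative-unique : ∀ {x} (p q : I) → x ≈ proj₁ p → x ≈ proj₁ q → p ≡ q
  representative-unique {x} (_ , m) (_ , m′) e e′ =
    let _ , _ , unique = representative x
    in  I-≡ (trans (sym (unique (m , e))) (unique (m′ , e′)))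

  ∨-represents : ∀ p q → band σ₀ k₀ (proj₁ p) (proj₁ q) ≈ proj₁ (p ∨ q)
  ∨-represents (p , _) (q , _) =
    let _ , (_ , e) , _ = representative (band σ₀ k₀ p q) in e

  ∨-upperˡ : ∀ p q → p ⪯ (p ∨ q)
  ∨-upperˡ p q = ⊑-trans (band-upperˡ σ₀ k₀ _ _) (proj₁ (∨-represents p q))

  ∨-upperʳ : ∀ p q → q ⪯ (p ∨ q)
  ∨-upperʳ p q = ⊑-trans (band-upperʳ σ₀ k₀ _ _) (proj₁ (∨-represents p q))

  -- The bound `z` ranges over the whole carrier, because joins are later compared with band
  -- products and operation values that need not be representatives.
  ∨-least : ∀ p q {z} → proj₁ p ⊑ z → proj₁ q ⊑ z → proj₁ (p ∨ q) ⊑ z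
  ∨-least p q p⊑z q⊑z = ⊑-trans (proj₂ (∨-represents p q)) (band-least σ₀ k₀ p⊑z q⊑z)

  isJoinSemilattice : IsJoinSemilattice _≡_ _⪯_ _∨_
  isJoinSemilattice = record
    { isPartialOrder = record
      { isPreorder = record
        { isEquivalence = isEquivalence
        ; reflexive     = λ { refl → ⊑-refl }
        ; trans         = ⊑-trans
        }
      ; antisym = λ {p} {q} p⊑q q⊑p →
          representative-unique p q (⊑-refl , ⊑-refl) (p⊑q , q⊑p)
      }
    ; supremum = λ p q → ∨-upperˡ p q , ∨-upperʳ p q , λ _ → ∨-least p q
    }

  ∨-independent : ∨-Independent
  ∨-independent σ k p q =
    band-least σ k (∨-upperˡ p q) (∨-upperʳ p q) ,
    ∨-least p q (band-upperˡ σ k _ _) (band-upperʳ σ k _ _)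

  -- The value is below `p` as a least upper bound. Conversely, positive arity provides a first
  -- argument `a`, with `p ⊑ a ⊑ ⟦ σ ⟧ as`.
  closed : Closed
  closed p σ as as≈p =
    op-least σ (All.map proj₁ as≈p) ,
    All-zipHead (λ e → ⊑-trans (proj₂ e)) as≈p (op-upper σ as)

  band-≈ʳ : ∀ σ k {x y} → x ⊑ y → band σ k x y ≈ y
  band-≈ʳ σ k x⊑y = band-least σ k x⊑y ⊑-refl , band-upperʳ σ k _ _

  constantsClosed : ConstantsClosed
  constantsClosed p ω eq as = band-≈ʳ ω zero (constant-least ω eq as (proj₁ p))

  ξ-wellDefined : ξ-WellDefined
  ξ-wellDefined p q p⪯q σ k (x , x≈p) = band-≈ʳ σ k (⊑-trans (proj₁ x≈p) p⪯q)

  -- The class algebras and the metamorphisms between them.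

  open ClassAlgebra closed constantsClosed

  -- Abstract in `n` and `f` so that the argument vector can be split, as `restrict` does: the empty
  -- case is the definition of the constants, the other is (PF4).
  restrict-mapᵢ : ∀ {n} p (f : Vec Carrier n → Carrier) (_⊙_ : Op₂ Carrier)
    (cl : .{{NonZero n}} → ∀ as → All (_≈ proj₁ p) as → f as ≈ proj₁ p)
    (co : n ≡ 0 → ∀ as → (f as ⊙ proj₁ p) ≈ proj₁ p)
    (_⟨_⟩_ : Carrier → Fin n → Carrier → Carrier) →
    (.{{NonZero n}} → ∀ as b → f as ⊙ b ≡ f (mapᵢ (λ k x → x ⟨ k ⟩ b) as)) →
    ∀ as (xs : Vec (Class p) n) →
    (∀ k → proj₁ (lookup xs k) ≡ lookup as k ⟨ k ⟩ proj₁ p) →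
    proj₁ (restrict p f _⊙_ cl co xs) ≡ f as ⊙ proj₁ p
  restrict-mapᵢ p f _⊙_ cl co _⟨_⟩_ pf4 []          []           eq = refl
  restrict-mapᵢ p f _⊙_ cl co _⟨_⟩_ pf4 as@(_ ∷ _) xs@(_ ∷ _) eq =
    trans (cong f (map≡tabulate xs eq)) (sym (pf4 as (proj₁ p)))

  classOp-band : ∀ p σ as (xs : Vec (Class p) (arity τ σ)) →
    (∀ k → proj₁ (lookup xs k) ≡ band σ (suc k) (lookup as k) (proj₁ p)) →
    proj₁ (Algebra.⟦ 𝐀[ p ] ⟧ σ xs) ≡ band σ zero (⟦ σ ⟧ as) (proj₁ p)
  classOp-band p σ = restrict-mapᵢ p ⟦ σ ⟧ (band σ zero)
    (λ {{_}} → closed p σ) (constantsClosed p σ)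
    (λ x k → band σ (suc k) x) (λ {{_}} → PF4 σ)

  ξ-metamorphic : ξ-Metamorphic ξ-wellDefined
  ξ-metamorphic p q p⪯q σ xs = Class-≡ (begin
    band σ zero (proj₁ (Algebra.⟦ 𝐀[ p ] ⟧ σ xs)) (proj₁ q)
      -- A member `x` of the class of `p` satisfies `x = x ⊙ p` for every band of the system, so the
      -- arguments already have the form that `classOp-band` expects.
      ≡⟨ cong (λ y → band σ zero y (proj₁ q)) (classOp-band p σ as xs λ k →
           trans (sym (⊑⇒⪯ σ (suc k) (proj₂ (proj₂ (lookup xs k)))))
                 (cong (λ y → band σ (suc k) y (proj₁ p)) (sym (lookup-map k proj₁ xs)))) ⟩
    band σ zero (band σ zero (⟦ σ ⟧ as) (proj₁ p)) (proj₁ q)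
      ≡⟨ band-absorb σ zero _ p⪯q ⟩
    band σ zero (⟦ σ ⟧ as) (proj₁ q)
      -- The same identity in the class of `q`, read from right to left.
      ≡⟨ classOp-band q σ as (mapᵢ ξ-σ xs) (λ k →
           trans (cong proj₁ (lookup∘tabulate (λ k → ξ-σ k (lookup xs k)) k))
                 (cong (λ y → band σ (suc k) y (proj₁ q)) (sym (lookup-map k proj₁ xs)))) ⟨
    proj₁ (Algebra.⟦ 𝐀[ q ] ⟧ σ (mapᵢ ξ-σ xs)) ∎)
    where
    open ≡-Reasoning
    as  = map proj₁ xs
    ξ-σ = λ k → ξ-components ξ-wellDefined p q p⪯q σ (suc k)

  -- The directed system and its least index.

  open Transition ξ-wellDefined ξ-metamorphic

  ξ-directed : ξ-Directed
  ξ-directed = record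
    { identity    = λ _ σ k (_ , e) → Class-≡ (⊑⇒⪯ σ k (proj₂ e))
    ; composition = λ _ q⪯s _ σ k (x , _) → Class-≡ (band-absorb σ k x q⪯s)
    }

  -- A constant lies below every element, so the representative of its class is a minimum of the
  -- index semilattice.
  least : HasConstant τ → ∃ (Minimum _⪯_)
  least (ω , eq) =
    let as = subst (Vec Carrier) (sym eq) []
        p , (p∈I , _ , p⊑ω) , _ = representative (⟦ ω ⟧ as)
    in  (p , p∈I) , λ q → ⊑-trans p⊑ω (constant-least ω eq as (proj₁ q))

  -- Comparison of the Płonka sum with the original algebra.

  𝐒 : DirectedSystem τ _ _ _
  𝐒 = system isJoinSemilattice ξ-directed

  minimum⊑ : ∀ p → Minimum _⪯_ p → ∀ z → proj₁ p ⊑ z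
  minimum⊑ p min z =
    let q , (q∈I , _ , q⊑z) , _ = representative z in ⊑-trans (min (q , q∈I)) q⊑z

  -- Applied with `z` the value of an operation, this puts the index of the Płonka sum below that
  -- value.
  join-least : ∀ {n} (⊥ : n ≡ 0 → ∃ (Minimum _⪯_)) (xs : Vec (∃ Class) n) {z} →
               All (_⊑ z) (map inclusion xs) → proj₁ (join 𝐒 least ⊥ xs) ⊑ z
  join-least ⊥ [] {z} [] = let p , min = ⊥ refl in minimum⊑ p min z
  join-least ⊥ ((_ , _ , e) ∷ []) (x⊑z ∷ []) = ⊑-trans (proj₂ e) x⊑z
  join-least ⊥ ((p , _ , e) ∷ xs@(_ ∷ _)) (x⊑z ∷ xs⊑z) =
    ∨-least p (join 𝐒 least (λ ()) xs) (⊑-trans (proj₂ e) x⊑z) (join-least (λ ()) xs xs⊑z)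

  inclusion-homomorphic : ∀ σ xs →
    inclusion (Algebra.⟦ PłonkaSum 𝐒 least ⟧ σ xs) ≡ ⟦ σ ⟧ (map inclusion xs)
  inclusion-homomorphic σ xs = trans
    (classOp-band q σ as (tabulate ys) λ k →
      trans (cong proj₁ (lookup∘tabulate ys k))
            (cong (λ y → band σ (suc k) y (proj₁ q)) (sym (lookup-map k inclusion xs))))
    -- The join `q` is below `⟦ σ ⟧ as`, which is an upper bound of its arguments; hence multiplying
    -- by `q` on the right changes nothing.
    (⊑⇒⪯ σ zero (join-least ⊥ xs (op-upper σ as)))
    where
    as = map inclusion xs
    ⊥  = λ eq → least (σ , eq)
    q  = join 𝐒 least ⊥ xs
    ys : ∀ k → Class q
    ys k =
      component (ξ {proj₁ (lookup xs k)} {q} (join-upper 𝐒 least ⊥ xs k)) σ (suc k)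
        (proj₂ (lookup xs k))

  inclusion-injective : Injective _≡_ _≡_ inclusion
  inclusion-injective {p , _ , e} {q , _ , e′} refl
    -- The classes are disjoint: a common element forces equal indices, after which only the class
    -- membership proofs remain to be identified.
    with refl ← representative-unique p q e e′ = cong (p ,_) (Class-≡ refl)

  inclusion-surjective : Surjective _≡_ _≡_ inclusion
  inclusion-surjective x =
    let p , (p∈I , x≈p) , _ = representative x
    in  ((p , p∈I) , x , x≈p) , λ { refl → refl }

  inclusion-isIsomorphism : IsIsomorphism (PłonkaSum 𝐒 least) 𝐀 inclusion
  inclusion-isIsomorphism = record
    { homomorphic = inclusion-homomorphic
    ; bijective   = inclusion-injective , inclusion-surjective
    }

theorem4p5 : {o a i : Level} {τ : Signature o} (𝐀 : Algebra τ a) (P : PartitionSystem 𝐀)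
    (σ₀ : Op τ) (k₀ : Fin (suc (arity τ σ₀)))
    (R : Representatives (Equivalence (PartitionSystem.band P σ₀ k₀)) i) →
    let open Decomposition P σ₀ k₀ R in
    Σ[ isJSL ∈ IsJoinSemilattice _≡_ _⪯_ _∨_ ]
    (∨-Independent ×
    (Σ[ closed ∈ Closed ] Σ[ constants ∈ ConstantsClosed ]
    (let open ClassAlgebra closed constants in
    Σ[ wd ∈ ξ-WellDefined ] Σ[ metamorphic ∈ ξ-Metamorphic wd ]
    (let open Transition wd metamorphic in
    Σ[ directed ∈ ξ-Directed ] Σ[ least ∈ (HasConstant τ → ∃ (Minimum _⪯_)) ]
    IsIsomorphism (PłonkaSum (system isJSL directed) least) 𝐀 inclusion))))
theorem4p5 𝐀 P σ₀ k₀ R =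
  isJoinSemilattice , ∨-independent , closed , constantsClosed ,
  ξ-wellDefined , ξ-metamorphic , ξ-directed , least , inclusion-isIsomorphism
  where open PartitionDecomposition P σ₀ k₀ R
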